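{- For all $m_1,\ldots,m_r,k_1,\ldots,k_r\in\mathbb{Z}_{\ge0}$, \[\mathbb{B}^{(-k_1,\ldots,-k_r)}_{m_1,\ldots,m_r}=\mathbb{B}^{(-m_1,\ldots,-m_r)}_{k_1,\ldots,k_r}.\]
   Context: For $s_1,\ldots,s_r\in\mathbb{C}$ and $|z_j|\le1$ (resp. as a rational function when all $s_j$ are non-positive integers), $\mathrm{Li}^{\sqcup\!\sqcup}_{s_1,\ldots,s_r}(z_1,\ldots,z_r)=\sum_{l_1,\ldots,l_r\ge1}\frac{z_1^{l_1}\cdots z_r^{l_r}}{l_1^{s_1}(l_1+l_2)^{s_2}\cdots(l_1+\cdots+l_r)^{s_r}}$. Write $X_j=\sum_{\nu=j}^r x_\nu$. The numbers $\mathbb{B}^{(s_1,\ldots,s_r)}_{m_1,\ldots,m_r}$ are defined by \[\frac{\mathrm{Li}^{\sqcup\!\sqcup}_{s_1,\ldots,s_r}(1-e^{ -X_1},\ldots,1-e^{ -X_r})}{\prod_{j=1}^r(1-e^{ -X_j})}=\sum_{l_1,\ldots,l_r\ge1}\frac{\prod_{j=1}^r(1-e^{ -X_j})^{l_j-1}}{\prod_{j=1}^r(l_1+\cdots+l_j)^{s_j}}=\sum_{m_1,\ldots,m_r\ge0}\mathbb{B}^{(s_1,\ldots,s_r)}_{m_1,\ldots,m_r}\frac{x_1^{m_1}\cdots x_r^{m_r}}{m_1!\cdots m_r!},\] the series converging for $(x_j)$ near $0$ with $|1-e^{ -X_j}|<1$ for all $j$. -}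

module Defs where

open import Data.Nat as ℕ using (ℕ; zero; suc; _!; _≤ᵇ_)
open import Data.Nat.Properties using (_!≢0)
open import Data.Integer as ℤ using (ℤ; +_)
open import Data.Rational as ℚ using (ℚ; 0ℚ; 1ℚ; _+_; _*_; _-_; -_; _/_)
open import Data.Fin using (Fin; toℕ)
open import Data.Vec as Vec using (Vec; []; _∷_)
open import Data.List as List using (List; []; _∷_; concatMap)
open import Data.Bool using (Bool; true; false; if_then_else_)
open import Data.Product using (_,_)

-- Multivariate formal power series over ℚ in r variables x₁,…,x_r,
-- represented by their (ordinary) coefficient function:
--   F = Σ_a F(a) x₁^{a₁}⋯x_r^{a_r},  a ∈ ℕ^r.

FPS : ℕ → Set
FPS r = Vec ℕ r → ℚ

ι : ℕ → ℚ
ι n = (+ n) / 1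

_^ℚ_ : ℚ → ℕ → ℚ
q ^ℚ zero  = 1ℚ
q ^ℚ suc n = q * (q ^ℚ n)

sumℚ : List ℚ → ℚ
sumℚ = List.foldr _+_ 0ℚ

below : ∀ {r} → Vec ℕ r → List (Vec ℕ r)
below []       = [] ∷ []
below (m ∷ ms) =
  concatMap (λ a → List.map (a ∷_) (below ms)) (List.upTo (suc m))

_∸v_ : ∀ {r} → Vec ℕ r → Vec ℕ r → Vec ℕ r
_∸v_ = Vec.zipWith ℕ._∸_

_⊛_ : ∀ {r} → FPS r → FPS r → FPS r
(f ⊛ g) m = sumℚ (List.map (λ a → f a * g (m ∸v a)) (below m))

allZero : ∀ {r} → Vec ℕ r → Bool
allZero []           = true
allZero (zero  ∷ as) = allZero as
allZero (suc _ ∷ as) = false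

oneS : ∀ {r} → FPS r
oneS m = if allZero m then 1ℚ else 0ℚ

_⊖_ : ∀ {r} → FPS r → FPS r → FPS r
(f ⊖ g) m = f m - g m

powS : ∀ {r} → FPS r → ℕ → FPS r
powS f zero    = oneS
powS f (suc n) = f ⊛ powS f n

expNegCoef : ℕ → ℚ
expNegCoef a = ((- 1ℚ) ^ℚ a) * ((+ 1) / (a !))
  where instance _ = a !≢0

oneCoef : ℕ → ℚ
oneCoef zero    = 1ℚ
oneCoef (suc _) = 0ℚ

-- e^{-X_j}, X_j = Σ_{ν ≥ j} x_ν, i.e. e^{-X_j} = Π_{ν ≥ j} e^{-x_ν}.
-- Helper: ν is the (0-based) index of the head variable.
expNegXAux : (j ν : ℕ) → ∀ {r} → Vec ℕ r → ℚ
expNegXAux j ν []       = 1ℚ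
expNegXAux j ν (a ∷ as) =
  (if j ≤ᵇ ν then expNegCoef a else oneCoef a) * expNegXAux j (suc ν) as

expNegX : ∀ {r} → Fin r → FPS r
expNegX j = expNegXAux (toℕ j) 0

T : ∀ {r} → Fin r → FPS r
T j = oneS ⊖ expNegX j

-- Π_j (1 - e^{-X_j})^{n_j}   (here n_j = l_j - 1)
prodT : ∀ {r} → Vec ℕ r → FPS r
prodT {r} n =
  Vec.foldr _ (λ { (j , nj) acc → powS (T j) nj ⊛ acc }) oneS
            (Vec.zip (Vec.allFin r) n)

-- Π_j (l_1+⋯+l_j)^{k_j}  with l_i = n_i + 1;  acc = l_1+⋯+l_{j-1}
weightAux : ℕ → ∀ {r} → Vec ℕ r → Vec ℕ r → ℕ
weightAux acc []       []       = 1
weightAux acc (k ∷ ks) (n ∷ ns) =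
  (acc ℕ.+ suc n) ℕ.^ k ℕ.* weightAux (acc ℕ.+ suc n) ks ns

weight : ∀ {r} → Vec ℕ r → Vec ℕ r → ℕ
weight = weightAux 0

totalDeg : ∀ {r} → Vec ℕ r → ℕ
totalDeg = Vec.foldr _ ℕ._+_ 0

factVec : ∀ {r} → Vec ℕ r → ℕ
factVec = Vec.foldr _ (λ a b → (a !) ℕ.* b) 1

-- The generating series (for s_j = -k_j)
--   G_k = Σ_{l_1,…,l_r ≥ 1} Π_j (1-e^{-X_j})^{l_j-1} · Π_j (l_1+⋯+l_j)^{k_j}
-- as a formal power series.  Since (1-e^{-X_j}) has no constant term,
-- the l-th summand has total degree ≥ Σ_j (l_j - 1); hence the
-- coefficient of x^m only receives contributions from the finitely
-- many l with l_j - 1 ≤ |m| for all j (all other summands vanish there).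
-- This is exactly the coefficient of the (formally convergent) sum.

Gcoef : ∀ {r} → (k : Vec ℕ r) → FPS r
Gcoef {r} k m =
  sumℚ (List.map (λ n → ι (weight k n) * prodT n m)
                 (below (Vec.replicate r (totalDeg m))))

-- 𝔹^{(-k_1,…,-k_r)}_{m_1,…,m_r} = m_1!⋯m_r! · [x^m] G_k
𝔹 : ∀ {r} → (k m : Vec ℕ r) → ℚ
𝔹 k m = ι (factVec m) * Gcoef k m

{-# OPTIONS --safe #-}
module Submission where

-- Let W_k(z) = Π_ν (z₁ + ⋯ + z_ν)^{k_ν} and let ∇ be the backward difference.
-- Since e^{-X_j} lowers z_j by one in exp(Σ_ν (z₁ + ⋯ + z_ν) x_ν), the number
-- m₁!⋯m_r!·[x^m] Π_j (1 - e^{-X_j})^{n_j} is the mixed difference ∇ⁿW_m(0), so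
-- 𝔹 k m = Σ_n W_k(n + 1)·∇ⁿW_m(0).  This is the r-fold tensor power of the
-- one-variable form ⟨f, g⟩ = Σ_n f(n + 1)·∇ⁿg(0) on polynomials.  Summation by
-- parts gives ⟨f, g⟩ = f(1)·g(1) + ⟨Δf, Δg⟩, and as Δ is nilpotent on
-- polynomials, the form is symmetric.

open import Defs
open import Data.Bool using (if_then_else_)
open import Data.Fin using (Fin; zero; suc; toℕ)
import Data.Integer as ℤ
import Data.Integer.Properties as ℤₚ
open import Data.List as List using (List; []; _∷_; _++_; upTo; concatMap; applyUpTo)
open import Data.List.Properties using (map-upTo; map-∘; map-cong; applyUpTo-∷ʳ)
open import Data.Nat as ℕ using (ℕ; zero; suc; _∸_; _!; _≤_)
import Data.Nat.Properties as ℕₚ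
open import Data.Nat.Properties using (_!≢0)
open import Data.Product using (_×_; _,_; swap)
open import Data.Rational using (ℚ; 0ℚ; 1ℚ; _+_; _*_; _-_; -_; _/_; fromℚᵘ)
open import Data.Rational.Properties
open import Data.Rational.Solver using (module +-*-Solver)
open import Data.Rational.Unnormalised as ℚᵘ using (mkℚᵘ; *≡*)
import Data.Rational.Unnormalised.Properties as ℚᵘₚ
open import Data.Unit using (⊤; tt)
open import Data.Vec as Vec using (Vec; []; _∷_; replicate; zipWith; allFin)
open import Data.Vec.Properties using (tabulate-allFin; zipWith-identityˡ)
open import Function using (_∘_; id)
open import Relation.Binary.PropositionalEquality
open ≡-Reasoning
open +-*-Solver using (solve; _:+_; _:*_; _:-_; _:=_; con)

-- Linear functionals and finite sums

-- The obstacle is that W_k does not split into factors of one coordinate each, so symmetry of ⟨f,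
-- g⟩ for pairs f, g cannot be iterated coordinate by coordinate. The forms therefore act on
-- functions b(x, z) of both arguments, and symmetry becomes invariance under `swap`. At each level
-- the inner form is a function of the two outer coordinates; being a linear functional, it commutes
-- with ∇ in a parameter and so passes degree bounds on to the outer form. Polynomials appear only
-- as functions ℚ → ℚ killed by some power of ∇, which is exactly what makes the sums finite. The
-- cutoff in 𝔹 k m depends on m alone, so both sides are first brought to a common cutoff.

record IsLinear {A : Set} (φ : (A → ℚ) → ℚ) : Set where
  field
    ≗-cong : ∀ {f g} → f ≗ g → φ f ≡ φ g
    +-homo : ∀ f g → φ (λ a → f a + g a) ≡ φ f + φ g
    *-homo : ∀ c f → φ (λ a → c * f a) ≡ c * φ f

  0-homo : φ (λ _ → 0ℚ) ≡ 0ℚ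
  0-homo = begin
    φ (λ _ → 0ℚ)         ≡⟨ ≗-cong (λ _ → sym (*-zeroˡ 0ℚ)) ⟩
    φ (λ _ → 0ℚ * 0ℚ)    ≡⟨ *-homo 0ℚ (λ _ → 0ℚ) ⟩
    0ℚ * φ (λ _ → 0ℚ)    ≡⟨ *-zeroˡ (φ (λ _ → 0ℚ)) ⟩
    0ℚ                   ∎

  ≗0⇒≡0 : ∀ {f} → (∀ a → f a ≡ 0ℚ) → φ f ≡ 0ℚ
  ≗0⇒≡0 f≗0 = trans (≗-cong f≗0) 0-homo

  sub-homo : ∀ f g → φ (λ a → f a - g a) ≡ φ f - φ g
  sub-homo f g = begin
    φ (λ a → f a - g a)            ≡⟨ ≗-cong (λ a → lem (f a) (g a)) ⟩
    φ (λ a → f a + - 1ℚ * g a)     ≡⟨ +-homo f _ ⟩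
    φ f + φ (λ a → - 1ℚ * g a)     ≡⟨ cong (φ f +_) (*-homo (- 1ℚ) g) ⟩
    φ f + - 1ℚ * φ g               ≡⟨ lem (φ f) (φ g) ⟨
    φ f - φ g                      ∎
    where
    lem : ∀ x y → x - y ≡ x + - 1ℚ * y
    lem = solve 2 (λ x y → x :- y := x :+ con (- 1ℚ) :* y) refl

  *-homoʳ : ∀ c f → φ (λ a → f a * c) ≡ φ f * c
  *-homoʳ c f = begin
    φ (λ a → f a * c)   ≡⟨ ≗-cong (λ a → *-comm (f a) c) ⟩
    φ (λ a → c * f a)   ≡⟨ *-homo c f ⟩
    c * φ f             ≡⟨ *-comm c (φ f) ⟩
    φ f * c             ∎

open IsLinear

eval-linear : ∀ {A : Set} (a : A) → IsLinear (λ f → f a)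
eval-linear a .≗-cong f≗g = f≗g a
eval-linear a .+-homo f g = refl
eval-linear a .*-homo c f = refl

-- The inner functional may depend on the variable of the outer one; iterated sums, iterated
-- differences and nested forms all have this shape.
∘-linear : ∀ {A B : Set} {φ : (A → ℚ) → ℚ} {ψ : A → (B → ℚ) → ℚ} →
           IsLinear φ → (∀ a → IsLinear (ψ a)) → IsLinear (λ f → φ (λ a → ψ a f))
∘-linear p q .≗-cong f≗g = p .≗-cong (λ a → q a .≗-cong f≗g)
∘-linear p q .+-homo f g = trans (p .≗-cong (λ a → q a .+-homo f g)) (p .+-homo _ _)
∘-linear p q .*-homo c f = trans (p .≗-cong (λ a → q a .*-homo c f)) (p .*-homo c _)

reindex-linear : ∀ {A B : Set} {φ : (A → ℚ) → ℚ} → IsLinear φ → (c : A → B) →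
                 IsLinear (λ f → φ (f ∘ c))
reindex-linear p c = ∘-linear p (λ a → eval-linear (c a))

difference-linear : ∀ {A : Set} {φ ψ : (A → ℚ) → ℚ} →
                    IsLinear φ → IsLinear ψ → IsLinear (λ f → φ f - ψ f)
difference-linear p q .≗-cong e = cong₂ _-_ (p .≗-cong e) (q .≗-cong e)
difference-linear {φ = φ} {ψ} p q .+-homo f g = begin
  φ (λ a → f a + g a) - ψ (λ a → f a + g a)   ≡⟨ cong₂ _-_ (p .+-homo f g) (q .+-homo f g) ⟩
  (φ f + φ g) - (ψ f + ψ g)                   ≡⟨ solve 4 (λ a b c d → (a :+ b) :- (c :+ d) := (a :- c) :+ (b :- d)) refl (φ f) (φ g) (ψ f) (ψ g) ⟩
  (φ f - ψ f) + (φ g - ψ g)                   ∎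
difference-linear {φ = φ} {ψ} p q .*-homo c f = begin
  φ (λ a → c * f a) - ψ (λ a → c * f a)   ≡⟨ cong₂ _-_ (p .*-homo c f) (q .*-homo c f) ⟩
  c * φ f - c * ψ f                       ≡⟨ solve 3 (λ a b c → c :* a :- c :* b := c :* (a :- b)) refl (φ f) (ψ f) c ⟩
  c * (φ f - ψ f)                         ∎

∑ : {A : Set} → List A → (A → ℚ) → ℚ
∑ xs f = sumℚ (List.map f xs)

∑-linear : ∀ {A : Set} (xs : List A) → IsLinear (∑ xs)
∑-linear xs .≗-cong f≗g = cong sumℚ (map-cong f≗g xs)
∑-linear [] .+-homo f g = refl
∑-linear (x ∷ xs) .+-homo f g = begin
  f x + g x + ∑ xs (λ a → f a + g a)   ≡⟨ cong (λ s → f x + g x + s) (∑-linear xs .+-homo f g) ⟩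
  f x + g x + (∑ xs f + ∑ xs g)        ≡⟨ solve 4 (λ a b c d → a :+ b :+ (c :+ d) := a :+ c :+ (b :+ d)) refl (f x) (g x) (∑ xs f) (∑ xs g) ⟩
  f x + ∑ xs f + (g x + ∑ xs g)        ∎
∑-linear [] .*-homo c f = sym (*-zeroʳ c)
∑-linear (x ∷ xs) .*-homo c f = begin
  c * f x + ∑ xs (λ a → c * f a)   ≡⟨ cong (λ s → c * f x + s) (∑-linear xs .*-homo c f) ⟩
  c * f x + c * ∑ xs f             ≡⟨ *-distribˡ-+ c (f x) (∑ xs f) ⟨
  c * (f x + ∑ xs f)               ∎

linear-∑ : ∀ {A B : Set} {φ : (A → ℚ) → ℚ} → IsLinear φ → (xs : List B) (F : B → A → ℚ) →
           φ (λ a → ∑ xs (λ x → F x a)) ≡ ∑ xs (λ x → φ (F x))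
linear-∑ p [] F = 0-homo p
linear-∑ {φ = φ} p (x ∷ xs) F = trans (p .+-homo (F x) _) (cong (φ (F x) +_) (linear-∑ p xs F))

∑-++ : ∀ {A : Set} (xs ys : List A) f → ∑ (xs ++ ys) f ≡ ∑ xs f + ∑ ys f
∑-++ [] ys f = sym (+-identityˡ _)
∑-++ (x ∷ xs) ys f = trans (cong (f x +_) (∑-++ xs ys f)) (sym (+-assoc (f x) _ _))

∑-concatMap : ∀ {A B C : Set} (g : A → B → C) (xs : List A) (ys : List B) f →
              ∑ (concatMap (λ a → List.map (g a) ys) xs) f ≡ ∑ xs (λ a → ∑ ys (λ b → f (g a b)))
∑-concatMap g [] ys f = refl
∑-concatMap g (x ∷ xs) ys f = begin
  ∑ (List.map (g x) ys ++ concatMap (λ a → List.map (g a) ys) xs) f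
    ≡⟨ ∑-++ (List.map (g x) ys) _ f ⟩
  ∑ (List.map (g x) ys) f + ∑ (concatMap (λ a → List.map (g a) ys) xs) f
    ≡⟨ cong₂ _+_ (cong sumℚ (sym (map-∘ ys))) (∑-concatMap g xs ys f) ⟩
  ∑ ys (λ b → f (g x b)) + ∑ xs (λ a → ∑ ys (λ b → f (g a b))) ∎

∑-below : ∀ {r} m (ms : Vec ℕ r) f →
          ∑ (below (m ∷ ms)) f ≡ ∑ (upTo (suc m)) (λ a → ∑ (below ms) (λ as → f (a ∷ as)))
∑-below m ms f = ∑-concatMap _∷_ (upTo (suc m)) (below ms) f

∑-upTo-head : ∀ n f → ∑ (upTo (suc n)) f ≡ f 0 + ∑ (upTo n) (f ∘ suc)
∑-upTo-head n f = begin
  ∑ (upTo (suc n)) f                     ≡⟨ cong sumℚ (map-upTo f (suc n)) ⟩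
  f 0 + sumℚ (applyUpTo (f ∘ suc) n)     ≡⟨ cong (λ s → f 0 + sumℚ s) (map-upTo (f ∘ suc) n) ⟨
  f 0 + ∑ (upTo n) (f ∘ suc)             ∎

∑-upTo-last : ∀ n f → ∑ (upTo (suc n)) f ≡ ∑ (upTo n) f + f n
∑-upTo-last n f = begin
  ∑ (upTo (suc n)) f                 ≡⟨ cong (λ xs → ∑ xs f) (applyUpTo-∷ʳ id n) ⟨
  ∑ (upTo n List.∷ʳ n) f             ≡⟨ ∑-++ (upTo n) (n ∷ []) f ⟩
  ∑ (upTo n) f + (f n + 0ℚ)          ≡⟨ cong (∑ (upTo n) f +_) (+-identityʳ (f n)) ⟩
  ∑ (upTo n) f + f n                 ∎

-- The embedding ι : ℕ → ℚ

-- `_/_` reduces to lowest terms, so identities of fractions are checked on unnormalised rationals,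
-- where they are equalities of cross products, and carried over by this homomorphism.
fromℚᵘ-homo-+ : ∀ p q → fromℚᵘ (p ℚᵘ.+ q) ≡ fromℚᵘ p + fromℚᵘ q
fromℚᵘ-homo-+ p q = toℚᵘ-injective (ℚᵘₚ.≃-trans (toℚᵘ-fromℚᵘ (p ℚᵘ.+ q)) (ℚᵘₚ.≃-sym
  (ℚᵘₚ.≃-trans (toℚᵘ-homo-+ (fromℚᵘ p) (fromℚᵘ q)) (ℚᵘₚ.+-cong (toℚᵘ-fromℚᵘ p) (toℚᵘ-fromℚᵘ q)))))

fromℚᵘ-homo-* : ∀ p q → fromℚᵘ (p ℚᵘ.* q) ≡ fromℚᵘ p * fromℚᵘ q
fromℚᵘ-homo-* p q = toℚᵘ-injective (ℚᵘₚ.≃-trans (toℚᵘ-fromℚᵘ (p ℚᵘ.* q)) (ℚᵘₚ.≃-sym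
  (ℚᵘₚ.≃-trans (toℚᵘ-homo-* (fromℚᵘ p) (fromℚᵘ q)) (ℚᵘₚ.*-cong (toℚᵘ-fromℚᵘ p) (toℚᵘ-fromℚᵘ q)))))

ι-+ : ∀ m n → ι (m ℕ.+ n) ≡ ι m + ι n
ι-+ m n = trans (fromℚᵘ-cong {mkℚᵘ (ℤ.+ (m ℕ.+ n)) 0} {mkℚᵘ (ℤ.+ m) 0 ℚᵘ.+ mkℚᵘ (ℤ.+ n) 0} (*≡* (cong (ℤ._* ℤ.+ 1) eq)))
  (fromℚᵘ-homo-+ (mkℚᵘ (ℤ.+ m) 0) (mkℚᵘ (ℤ.+ n) 0))
  where
  eq : ℤ.+ (m ℕ.+ n) ≡ ℤ.+ m ℤ.* ℤ.+ 1 ℤ.+ ℤ.+ n ℤ.* ℤ.+ 1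
  eq = cong₂ ℤ._+_ (sym (ℤₚ.*-identityʳ (ℤ.+ m))) (sym (ℤₚ.*-identityʳ (ℤ.+ n)))

ι-* : ∀ m n → ι (m ℕ.* n) ≡ ι m * ι n
ι-* m n = trans (fromℚᵘ-cong {mkℚᵘ (ℤ.+ (m ℕ.* n)) 0} {mkℚᵘ (ℤ.+ m) 0 ℚᵘ.* mkℚᵘ (ℤ.+ n) 0} (*≡* (cong (ℤ._* ℤ.+ 1) (ℤₚ.pos-* m n))))
  (fromℚᵘ-homo-* (mkℚᵘ (ℤ.+ m) 0) (mkℚᵘ (ℤ.+ n) 0))

ι-^ : ∀ m k → ι (m ℕ.^ k) ≡ ι m ^ℚ k
ι-^ m zero    = refl
ι-^ m (suc k) = trans (ι-* m (m ℕ.^ k)) (cong (ι m *_) (ι-^ m k))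

ι-suc : ∀ n → ι (suc n) ≡ ι n + 1ℚ
ι-suc n = trans (ι-+ 1 n) (+-comm 1ℚ (ι n))

1/-* : ∀ m n .{{_ : ℕ.NonZero m}} .{{_ : ℕ.NonZero n}} .{{_ : ℕ.NonZero (m ℕ.* n)}} →
       (ℤ.+ 1 / (m ℕ.* n)) ≡ (ℤ.+ 1 / m) * (ℤ.+ 1 / n)
1/-* (suc m) (suc n) = fromℚᵘ-homo-* (mkℚᵘ (ℤ.+ 1) m) (mkℚᵘ (ℤ.+ 1) n)

ι-1/ : ∀ n .{{_ : ℕ.NonZero n}} → ι n * (ℤ.+ 1 / n) ≡ 1ℚ
ι-1/ (suc n) = trans (sym (fromℚᵘ-homo-* (mkℚᵘ (ℤ.+ suc n) 0) (mkℚᵘ (ℤ.+ 1) n)))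
  (fromℚᵘ-cong {mkℚᵘ (ℤ.+ suc n) 0 ℚᵘ.* mkℚᵘ (ℤ.+ 1) n} {mkℚᵘ (ℤ.+ 1) 0} (*≡* (trans (ℤₚ.*-identityʳ _)
    (trans (ℤₚ.*-comm (ℤ.+ suc n) (ℤ.+ 1)) (sym (ℤₚ.*-identityˡ _))))))

-- Backward differences

∇ : (ℚ → ℚ) → ℚ → ℚ
∇ f z = f z - f (z - 1ℚ)

-- The extra difference acts innermost, so that `Deg< (suc N) f` is by definition `Deg< N (∇ f)`.
∇^ : ℕ → (ℚ → ℚ) → ℚ → ℚ
∇^ zero    f = f
∇^ (suc n) f = ∇^ n (∇ f)

∇^-linear : ∀ n z → IsLinear (λ f → ∇^ n f z)
∇^-linear zero    z = eval-linear z
∇^-linear (suc n) z =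
  ∘-linear (∇^-linear n z) (λ y → difference-linear (eval-linear y) (eval-linear (y - 1ℚ)))

∇^-cong : ∀ n {f g} → f ≗ g → ∇^ n f ≗ ∇^ n g
∇^-cong n f≗g z = ∇^-linear n z .≗-cong f≗g

∇^-shift : ∀ n f c z → ∇^ n (λ y → f (y + c)) z ≡ ∇^ n f (z + c)
∇^-shift zero    f c z = refl
∇^-shift (suc n) f c z = trans
  (∇^-cong n (λ y → cong (λ x → f (y + c) - f x)
    (solve 2 (λ y c → y :- con 1ℚ :+ c := y :+ c :- con 1ℚ) refl y c)) z)
  (∇^-shift n (∇ f) c z)

linear-∇^ : ∀ {A : Set} {φ : (A → ℚ) → ℚ} → IsLinear φ → ∀ n (F : ℚ → A → ℚ) z →
            ∇^ n (λ y → φ (F y)) z ≡ φ (λ a → ∇^ n (λ y → F y a) z)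
linear-∇^ p zero    F z = refl
linear-∇^ p (suc n) F z = trans
  (∇^-cong n (λ y → sym (sub-homo p (F y) (F (y - 1ℚ)))) z)
  (linear-∇^ p n (λ y a → F y a - F (y - 1ℚ) a) z)

-- For polynomial functions this says that the degree is less than N.
Deg< : ℕ → (ℚ → ℚ) → Set
Deg< N f = ∀ z → ∇^ N f z ≡ 0ℚ

Deg<-cong : ∀ N {f g} → f ≗ g → Deg< N f → Deg< N g
Deg<-cong N f≗g d z = trans (∇^-cong N (λ y → sym (f≗g y)) z) (d z)

Deg<-suc : ∀ N {f} → Deg< N f → Deg< (suc N) f
Deg<-suc zero    d z = cong₂ _-_ (d z) (d (z - 1ℚ))
Deg<-suc (suc N) d   = Deg<-suc N d

Deg<-mono : ∀ o N {f} → Deg< N f → Deg< (o ℕ.+ N) f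
Deg<-mono zero    N d = d
Deg<-mono (suc o) N d = Deg<-suc (o ℕ.+ N) (Deg<-mono o N d)

Deg<-+ : ∀ N {f g} → Deg< N f → Deg< N g → Deg< N (λ z → f z + g z)
Deg<-+ N d e z = trans (∇^-linear N z .+-homo _ _) (cong₂ _+_ (d z) (e z))

Deg<-sub : ∀ N {f g} → Deg< N f → Deg< N g → Deg< N (λ z → f z - g z)
Deg<-sub N d e z = trans (sub-homo (∇^-linear N z) _ _) (cong₂ _-_ (d z) (e z))

Deg<-scale : ∀ N c {f} → Deg< N f → Deg< N (λ z → c * f z)
Deg<-scale N c d z = trans (∇^-linear N z .*-homo c _) (trans (cong (c *_) (d z)) (*-zeroʳ c))

Deg<-shift : ∀ N c {f} → Deg< N f → Deg< N (λ z → f (z + c))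
Deg<-shift N c d z = trans (∇^-shift N _ c z) (d (z + c))

-- With φ an inner `form`, this bounds the degree of the function seen by the outer `pairing`.
Deg<-linear : ∀ {A : Set} {φ : (A → ℚ) → ℚ} → IsLinear φ → ∀ N (F : ℚ → A → ℚ) →
              (∀ a → Deg< N (λ z → F z a)) → Deg< N (λ z → φ (F z))
Deg<-linear p N F d z = trans (linear-∇^ p N F z) (≗0⇒≡0 p (λ a → d a z))

Deg<-Δ : ∀ N {f} → Deg< (suc N) f → Deg< N (λ z → f (z + 1ℚ) - f z)
Deg<-Δ N {f} d = Deg<-cong N
  (λ z → cong (λ x → f (z + 1ℚ) - f x) (solve 1 (λ z → z :+ con 1ℚ :- con 1ℚ := z) refl z))
  (Deg<-shift N 1ℚ {∇ f} d)

-- Discrete product rule: ∇((c + z)·f(z)) = (c + z)·∇f(z) + f(z - 1), where induction handles the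
-- first summand.
Deg<-linear-factor : ∀ c N {f} → Deg< N f → Deg< (suc N) (λ z → (c + z) * f z)
Deg<-linear-factor c zero    {f} d z = begin
  (c + z) * f z - (c + (z - 1ℚ)) * f (z - 1ℚ)
    ≡⟨ cong₂ (λ a b → (c + z) * a - (c + (z - 1ℚ)) * b) (d z) (d (z - 1ℚ)) ⟩
  (c + z) * 0ℚ - (c + (z - 1ℚ)) * 0ℚ
    ≡⟨ solve 2 (λ a b → a :* con 0ℚ :- b :* con 0ℚ := con 0ℚ) refl (c + z) (c + (z - 1ℚ)) ⟩
  0ℚ ∎
Deg<-linear-factor c (suc N) {f} d = Deg<-cong (suc N)
  (λ z → solve 4 (λ c z u v → (c :+ z) :* (u :- v) :+ v
                           := (c :+ z) :* u :- (c :+ (z :- con 1ℚ)) :* v)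
           refl c z (f z) (f (z - 1ℚ)))
  (Deg<-+ (suc N) {λ z → (c + z) * ∇ f z} {λ z → f (z - 1ℚ)} (Deg<-linear-factor c N {∇ f} d) (Deg<-shift (suc N) (- 1ℚ) {f} d))

-- The symmetric form

-- The one-variable form Σ_{n<N} f(n+1)·∇ⁿg(0), extended linearly to b(x,z) = f(x)·g(z).
pairing : ℕ → (ℚ × ℚ → ℚ) → ℚ
pairing N b = ∑ (upTo N) (λ n → ∇^ n (λ z → b (ι (suc n) , z)) 0ℚ)

pairing-linear : ∀ N → IsLinear (pairing N)
pairing-linear N = ∘-linear (∑-linear (upTo N)) (λ n → reindex-linear (∇^-linear n 0ℚ) (ι (suc n) ,_))

-- The operator Δ ⊗ Δ: it sends f(x)·g(z) to Δf(x)·Δg(z).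
mixedΔ : (ℚ × ℚ → ℚ) → ℚ × ℚ → ℚ
mixedΔ b (x , z) = (b (x + 1ℚ , z + 1ℚ) - b (x + 1ℚ , z)) - (b (x , z + 1ℚ) - b (x , z))

-- Summation by parts, after writing b = c − ∇c with c(x,z) = b(x,z+1).
pairing-suc : ∀ N b → (∀ x → Deg< (suc N) (λ z → b (x , z))) →
              pairing (suc N) b ≡ b (1ℚ , 1ℚ) + pairing N (mixedΔ b)
pairing-suc N b d = begin
  ∑ (upTo (suc N)) (λ n → ∇^ n (λ z → b (ι (suc n) , z)) 0ℚ)
    ≡⟨ ∑-linear (upTo (suc N)) .≗-cong split ⟩
  ∑ (upTo (suc N)) (λ n → p n - q n)
    ≡⟨ sub-homo (∑-linear (upTo (suc N))) p q ⟩
  ∑ (upTo (suc N)) p - ∑ (upTo (suc N)) q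
    -- The sums are split at opposite ends to match `p (suc n)` with `q n`: both take ∇^(n+1) of `c`
    -- at 0, at the neighbouring first arguments n + 2 and n + 1.
    ≡⟨ cong₂ _-_ (∑-upTo-head N p) (∑-upTo-last N q) ⟩
  p 0 + ∑ (upTo N) (p ∘ suc) - (∑ (upTo N) q + q N)
    -- The boundary term `q N` is the (N+1)-st difference of a shifted section of `b`, which the
    -- degree bound kills.
    ≡⟨ cong (λ y → p 0 + ∑ (upTo N) (p ∘ suc) - (∑ (upTo N) q + y))
         (Deg<-shift (suc N) 1ℚ {λ z → b (ι (suc N) , z)} (d (ι (suc N))) 0ℚ) ⟩
  p 0 + ∑ (upTo N) (p ∘ suc) - (∑ (upTo N) q + 0ℚ)
    ≡⟨ solve 3 (λ x y z → x :+ y :- (z :+ con 0ℚ) := x :+ (y :- z)) refl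
         (p 0) (∑ (upTo N) (p ∘ suc)) (∑ (upTo N) q) ⟩
  p 0 + (∑ (upTo N) (p ∘ suc) - ∑ (upTo N) q)
    ≡⟨ cong (λ y → p 0 + y) (sub-homo (∑-linear (upTo N)) (p ∘ suc) q) ⟨
  p 0 + ∑ (upTo N) (λ n → p (suc n) - q n)
    ≡⟨ cong (λ y → p 0 + y) (∑-linear (upTo N) .≗-cong merge) ⟩
  b (1ℚ , 1ℚ) + pairing N (mixedΔ b) ∎
  where
  c : ℚ → ℚ → ℚ
  c x z = b (x , z + 1ℚ)

  p q : ℕ → ℚ
  p n = ∇^ n (c (ι (suc n))) 0ℚ
  q n = ∇^ (suc n) (c (ι (suc n))) 0ℚ

  z-1+1 : ∀ z → z - 1ℚ + 1ℚ ≡ z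
  z-1+1 = solve 1 (λ z → z :- con 1ℚ :+ con 1ℚ := z) refl

  split : ∀ n → ∇^ n (λ z → b (ι (suc n) , z)) 0ℚ ≡ p n - q n
  split n = trans
    (∇^-cong n (λ z → trans (cong (λ y → b (ι (suc n) , y)) (sym (z-1+1 z)))
      (solve 2 (λ u v → v := u :- (u :- v)) refl (c (ι (suc n)) z) (c (ι (suc n)) (z - 1ℚ)))) 0ℚ)
    (sub-homo (∇^-linear n 0ℚ) (c (ι (suc n))) (∇ (c (ι (suc n)))))

  merge : ∀ n → p (suc n) - q n ≡ ∇^ n (λ z → mixedΔ b (ι (suc n) , z)) 0ℚ
  merge n = trans
    (sym (sub-homo (∇^-linear n 0ℚ) (∇ (c (ι (suc (suc n))))) (∇ (c (ι (suc n))))))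
    (∇^-cong n (λ z → cong₂ (λ x y → (b (x , z + 1ℚ) - b (x , y)) - (b (ι (suc n) , z + 1ℚ) - b (ι (suc n) , y)))
      (ι-suc (suc n)) (z-1+1 z)) 0ℚ)

mixedΔ-swap : ∀ b x z → mixedΔ b (x , z) ≡ mixedΔ (b ∘ swap) (z , x)
mixedΔ-swap b x z =
  solve 4 (λ s t u v → (s :- t) :- (u :- v) := (s :- u) :- (t :- v)) refl
    (b (x + 1ℚ , z + 1ℚ)) (b (x + 1ℚ , z)) (b (x , z + 1ℚ)) (b (x , z))

Deg<-mixedΔ : ∀ N b → (∀ x → Deg< (suc N) (λ z → b (x , z))) →
              ∀ x → Deg< N (λ z → mixedΔ b (x , z))
Deg<-mixedΔ N b d x =
  Deg<-sub N {λ z → b (x + 1ℚ , z + 1ℚ) - b (x + 1ℚ , z)} {λ z → b (x , z + 1ℚ) - b (x , z)}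
    (Deg<-Δ N {λ z → b (x + 1ℚ , z)} (d (x + 1ℚ))) (Deg<-Δ N {λ z → b (x , z)} (d x))

-- Summation by parts on each side leaves the same corner value b(1, 1) and lowers the degree bounds
-- in both variables; at N = 0 both sums are empty.
pairing-swap : ∀ N b → (∀ x → Deg< N (λ z → b (x , z))) → (∀ z → Deg< N (λ x → b (x , z))) →
               pairing N b ≡ pairing N (b ∘ swap)
pairing-swap zero    b d e = refl
pairing-swap (suc N) b d e = begin
  pairing (suc N) b                               ≡⟨ pairing-suc N b d ⟩
  b (1ℚ , 1ℚ) + pairing N (mixedΔ b)              ≡⟨ cong (λ y → b (1ℚ , 1ℚ) + y) ih ⟩
  b (1ℚ , 1ℚ) + pairing N (mixedΔ (b ∘ swap))     ≡⟨ pairing-suc N (b ∘ swap) e ⟨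
  pairing (suc N) (b ∘ swap)                      ∎
  where
  ih : pairing N (mixedΔ b) ≡ pairing N (mixedΔ (b ∘ swap))
  ih = trans
    (pairing-swap N (mixedΔ b) (Deg<-mixedΔ N b d)
      (λ z → Deg<-cong N (λ x → sym (mixedΔ-swap b x z)) (Deg<-mixedΔ N (b ∘ swap) e z)))
    (pairing-linear N .≗-cong (λ (x , z) → mixedΔ-swap b z x))

pairing-extend : ∀ o N b → (∀ x → Deg< N (λ z → b (x , z))) → pairing (o ℕ.+ N) b ≡ pairing N b
pairing-extend zero    N b d = refl
pairing-extend (suc o) N b d = begin
  pairing (suc (o ℕ.+ N)) b
    ≡⟨ ∑-upTo-last (o ℕ.+ N) (λ n → ∇^ n (λ z → b (ι (suc n) , z)) 0ℚ) ⟩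
  pairing (o ℕ.+ N) b + ∇^ (o ℕ.+ N) (λ z → b (ι (suc (o ℕ.+ N)) , z)) 0ℚ
    ≡⟨ cong₂ _+_ (pairing-extend o N b d) (Deg<-mono o N (d (ι (suc (o ℕ.+ N)))) 0ℚ) ⟩
  pairing N b + 0ℚ
    ≡⟨ +-identityʳ _ ⟩
  pairing N b ∎

-- Each level pairs the first coordinates of the two vectors; `h` is an arbitrary function, since
-- the kernels of interest do not factor over coordinates.
form : ∀ {r} → ℕ → (Vec ℚ r × Vec ℚ r → ℚ) → ℚ
form {zero}  N h = h ([] , [])
form {suc r} N h = pairing N (λ (x , z) → form N (λ (u , v) → h (x ∷ u , z ∷ v)))

form-linear : ∀ r N → IsLinear (form {r} N)
form-linear zero    N = eval-linear ([] , [])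
form-linear (suc r) N =
  ∘-linear (pairing-linear N) (λ (x , z) → reindex-linear (form-linear r N) (λ (u , v) → x ∷ u , z ∷ v))

-- A bound in each coordinate of the second vector separately, all others being fixed.
RightDeg< : ∀ {r} → ℕ → (Vec ℚ r × Vec ℚ r → ℚ) → Set
RightDeg< {zero}  N h = ⊤
RightDeg< {suc r} N h = (∀ x u v → Deg< N (λ z → h (x ∷ u , z ∷ v)))
                      × (∀ x z → RightDeg< N (λ (u , v) → h (x ∷ u , z ∷ v)))

form-swap : ∀ r N (h : Vec ℚ r × Vec ℚ r → ℚ) → RightDeg< N h → RightDeg< N (h ∘ swap) →
            form N h ≡ form N (h ∘ swap)
form-swap zero    N h d e = refl
form-swap (suc r) N h (d , ds) (e , es) = trans
  (pairing-swap N _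
    (λ x → Deg<-linear (form-linear r N) N (λ z (u , v) → h (x ∷ u , z ∷ v)) (λ (u , v) → d x u v))
    (λ z → Deg<-linear (form-linear r N) N (λ x (u , v) → h (x ∷ u , z ∷ v)) (λ (u , v) → e z v u)))
  (pairing-linear N .≗-cong (λ (z , x) → form-swap r N (λ (u , v) → h (x ∷ u , z ∷ v)) (ds x z) (es z x)))

form-extend : ∀ r o N (h : Vec ℚ r × Vec ℚ r → ℚ) → RightDeg< N h → form (o ℕ.+ N) h ≡ form N h
form-extend zero    o N h d = refl
form-extend (suc r) o N h (d , ds) = trans
  (pairing-linear (o ℕ.+ N) .≗-cong (λ (x , z) → form-extend r o N (λ (u , v) → h (x ∷ u , z ∷ v)) (ds x z)))
  (pairing-extend o N _
    (λ x → Deg<-linear (form-linear r N) N (λ z (u , v) → h (x ∷ u , z ∷ v)) (λ (u , v) → d x u v)))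

mixed∇ : ∀ {r} → Vec ℕ r → (Vec ℚ r → ℚ) → ℚ
mixed∇ []       g = g []
mixed∇ (n ∷ ns) g = ∇^ n (λ z → mixed∇ ns (λ v → g (z ∷ v))) 0ℚ

mixed∇-linear : ∀ {r} (ns : Vec ℕ r) → IsLinear (mixed∇ ns)
mixed∇-linear []       = eval-linear []
mixed∇-linear (n ∷ ns) = ∘-linear (∇^-linear n 0ℚ) (λ z → reindex-linear (mixed∇-linear ns) (z ∷_))

ι⁺ : ∀ {r} → Vec ℕ r → Vec ℚ r
ι⁺ = Vec.map (ι ∘ suc)

-- Collects the nested sums into one over the box `below`, the index set of `Gcoef`; indices below
-- `suc N` are those up to N.
form-∑ : ∀ r N (h : Vec ℚ r × Vec ℚ r → ℚ) →
         form (suc N) h ≡ ∑ (below (replicate r N)) (λ n → mixed∇ n (λ v → h (ι⁺ n , v)))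
form-∑ zero    N h = sym (+-identityʳ _)
form-∑ (suc r) N h = begin
  ∑ (upTo (suc N)) (λ n → ∇^ n (λ z → form (suc N) (λ (u , v) → h (ι (suc n) ∷ u , z ∷ v))) 0ℚ)
    ≡⟨ ∑-linear (upTo (suc N)) .≗-cong inner ⟩
  ∑ (upTo (suc N)) (λ n → ∑ (below (replicate r N)) (λ ns → mixed∇ (n ∷ ns) (λ v → h (ι⁺ (n ∷ ns) , v))))
    ≡⟨ ∑-below N (replicate r N) _ ⟨
  ∑ (below (N ∷ replicate r N)) (λ n → mixed∇ n (λ v → h (ι⁺ n , v))) ∎
  where
  inner : ∀ n → ∇^ n (λ z → form (suc N) (λ (u , v) → h (ι (suc n) ∷ u , z ∷ v))) 0ℚ
              ≡ ∑ (below (replicate r N)) (λ ns → mixed∇ (n ∷ ns) (λ v → h (ι⁺ (n ∷ ns) , v)))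
  inner n = trans
    (∇^-cong n (λ z → form-∑ r N (λ (u , v) → h (ι (suc n) ∷ u , z ∷ v))) 0ℚ)
    (linear-∑ (∇^-linear n 0ℚ) (below (replicate r N)) (λ ns z → mixed∇ ns (λ v → h (ι⁺ (n ∷ ns) , z ∷ v))))

-- Prefix monomials

-- Π_ν (c + z₁ + ⋯ + z_ν)^{k_ν}
prefixMonomial : ∀ {r} → ℚ → Vec ℕ r → Vec ℚ r → ℚ
prefixMonomial c []       []       = 1ℚ
prefixMonomial c (k ∷ ks) (z ∷ zs) = (c + z) ^ℚ k * prefixMonomial (c + z) ks zs

prefixMonomial-weight : ∀ {r} a (k n : Vec ℕ r) → ι (weightAux a k n) ≡ prefixMonomial (ι a) k (ι⁺ n)
prefixMonomial-weight a []       []       = refl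
prefixMonomial-weight a (k ∷ ks) (n ∷ ns) = begin
  ι (b ℕ.^ k ℕ.* weightAux b ks ns)                     ≡⟨ ι-* (b ℕ.^ k) _ ⟩
  ι (b ℕ.^ k) * ι (weightAux b ks ns)                   ≡⟨ cong₂ _*_ (ι-^ b k) (prefixMonomial-weight b ks ns) ⟩
  ι b ^ℚ k * prefixMonomial (ι b) ks (ι⁺ ns)            ≡⟨ cong (λ y → y ^ℚ k * prefixMonomial y ks (ι⁺ ns)) (ι-+ a (suc n)) ⟩
  prefixMonomial (ι a) (k ∷ ks) (ι⁺ (n ∷ ns))           ∎
  where b = a ℕ.+ suc n

Deg<-≤ : ∀ {M N f} → M ≤ N → Deg< M f → Deg< N f
Deg<-≤ {M} {N} {f} M≤N d = subst (λ n → Deg< n f) (ℕₚ.m∸n+n≡m M≤N) (Deg<-mono (N ∸ M) M d)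

Deg<-power-factor : ∀ c k N {f} → Deg< N f → Deg< (k ℕ.+ N) (λ z → (c + z) ^ℚ k * f z)
Deg<-power-factor c zero    N {f} d = Deg<-cong N (λ z → sym (*-identityˡ (f z))) d
Deg<-power-factor c (suc k) N {f} d = Deg<-cong (suc (k ℕ.+ N))
  (λ z → sym (*-assoc (c + z) ((c + z) ^ℚ k) (f z)))
  (Deg<-linear-factor c (k ℕ.+ N) (Deg<-power-factor c k N d))

-- Moving the offset moves every prefix sum at once, so all exponents add up in the degree.
Deg<-prefixMonomial : ∀ {r} (ks : Vec ℕ r) zs c →
                      Deg< (suc (totalDeg ks)) (λ z → prefixMonomial (c + z) ks zs)
Deg<-prefixMonomial []       []       c z = refl
Deg<-prefixMonomial (k ∷ ks) (x ∷ zs) c = Deg<-≤ (ℕₚ.≤-reflexive (ℕₚ.+-suc k (totalDeg ks)))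
  (Deg<-cong (k ℕ.+ suc (totalDeg ks))
    (λ z → cong (λ y → y ^ℚ k * prefixMonomial y ks zs)
      (solve 3 (λ c x z → c :+ x :+ z := c :+ z :+ x) refl c x z))
    (Deg<-power-factor (c + x) k (suc (totalDeg ks)) (Deg<-prefixMonomial ks zs (c + x))))

-- The left factor `f` is general so that, once z is fixed, it can absorb (c + z)^k in the
-- recursion.
RightDeg<-prefixMonomial : ∀ {r} N c (ks : Vec ℕ r) → totalDeg ks ℕ.< N → ∀ (f : Vec ℚ r → ℚ) {h} →
                           (∀ u v → h (u , v) ≡ f u * prefixMonomial c ks v) → RightDeg< N h
RightDeg<-prefixMonomial N c []       lt f eq = tt
RightDeg<-prefixMonomial N c (k ∷ ks) lt f {h} eq =
    (λ x u v → Deg<-cong N (λ z → sym (eq (x ∷ u) (z ∷ v)))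
      (Deg<-scale N (f (x ∷ u)) (Deg<-≤ (ℕₚ.≤-trans (ℕₚ.≤-reflexive (ℕₚ.+-suc k (totalDeg ks))) lt)
        (Deg<-power-factor c k (suc (totalDeg ks)) (Deg<-prefixMonomial ks v c)))))
  , (λ x z → RightDeg<-prefixMonomial N (c + z) ks (ℕₚ.≤-<-trans (ℕₚ.m≤n+m (totalDeg ks) k) lt)
      (λ u → f (x ∷ u) * (c + z) ^ℚ k)
      (λ u v → trans (eq (x ∷ u) (z ∷ v)) (sym (*-assoc (f (x ∷ u)) ((c + z) ^ℚ k) _))))

-- Exponential series

-- The coefficient of xᵃ in e^{yx}.
expCoef : ℚ → ℕ → ℚ
expCoef y a = (y ^ℚ a) * (ℤ.+ 1 / (a !))
  where instance _ = a !≢0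

expCoef-suc : ∀ y a → ι (suc a) * expCoef y (suc a) ≡ y * expCoef y a
expCoef-suc y a = begin
  ι (suc a) * (y * y ^ℚ a * (ℤ.+ 1 / (suc a ℕ.* a !)))
    ≡⟨ cong (λ q → ι (suc a) * (y * y ^ℚ a * q)) (1/-* (suc a) (a !)) ⟩
  ι (suc a) * (y * y ^ℚ a * ((ℤ.+ 1 / suc a) * (ℤ.+ 1 / (a !))))
    ≡⟨ solve 5 (λ i y p q s → i :* (y :* p :* (q :* s)) := (i :* q) :* (y :* (p :* s))) refl
         (ι (suc a)) y (y ^ℚ a) (ℤ.+ 1 / suc a) (ℤ.+ 1 / (a !)) ⟩
  (ι (suc a) * (ℤ.+ 1 / suc a)) * (y * expCoef y a)
    ≡⟨ cong (_* (y * expCoef y a)) (ι-1/ (suc a)) ⟩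
  1ℚ * (y * expCoef y a)
    ≡⟨ *-identityˡ _ ⟩
  y * expCoef y a ∎
  where
  instance
    _ = a !≢0
    _ = suc a !≢0

convolution : (ℕ → ℚ) → (ℕ → ℚ) → ℕ → ℚ
convolution f g m = ∑ (upTo (suc m)) (λ a → f a * g (m ∸ a))

convolution-suc : ∀ f g m → convolution f g (suc m) ≡ f 0 * g (suc m) + convolution (f ∘ suc) g m
convolution-suc f g m = ∑-upTo-head (suc m) (λ a → f a * g (suc m ∸ a))

derivative : (ℕ → ℚ) → ℕ → ℚ
derivative f a = ι (suc a) * f (suc a)

-- The product rule (FG)′ = F′G + FG′ for power series, read off at x^m.
convolution-leibniz : ∀ f g m → ι (suc m) * convolution f g (suc m)
                              ≡ convolution (derivative f) g m + convolution f (derivative g) m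
convolution-leibniz f g zero =
  solve 5 (λ i f₀ f₁ g₀ g₁ → i :* (f₀ :* g₁ :+ (f₁ :* g₀ :+ con 0ℚ))
                          := i :* f₁ :* g₀ :+ con 0ℚ :+ (f₀ :* (i :* g₁) :+ con 0ℚ)) refl
    (ι 1) (f 0) (f 1) (g 0) (g 1)
convolution-leibniz f g (suc m) = begin
  ι (2 ℕ.+ m) * convolution f g (2 ℕ.+ m)
    ≡⟨ cong (ι (2 ℕ.+ m) *_) (convolution-suc f g (suc m)) ⟩
  ι (2 ℕ.+ m) * (f 0 * g (2 ℕ.+ m) + C)
    ≡⟨ *-distribˡ-+ (ι (2 ℕ.+ m)) (f 0 * g (2 ℕ.+ m)) C ⟩
  ι (2 ℕ.+ m) * (f 0 * g (2 ℕ.+ m)) + ι (2 ℕ.+ m) * C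
    -- Of m + 2 = (m + 1) + 1, the first part feeds the induction hypothesis for `f ∘ suc`; the
    -- second corrects the index shift in `derivative`, as in `D+D′`.
    ≡⟨ cong (λ i → ι (2 ℕ.+ m) * (f 0 * g (2 ℕ.+ m)) + i * C) (ι-suc (suc m)) ⟩
  ι (2 ℕ.+ m) * (f 0 * g (2 ℕ.+ m)) + (ι (suc m) + 1ℚ) * C
    ≡⟨ solve 5 (λ i f₀ g₂ j c → i :* (f₀ :* g₂) :+ (j :+ con 1ℚ) :* c
                             := f₀ :* (i :* g₂) :+ (j :* c :+ c)) refl
         (ι (2 ℕ.+ m)) (f 0) (g (2 ℕ.+ m)) (ι (suc m)) C ⟩
  f 0 * derivative g (suc m) + (ι (suc m) * C + C)
    ≡⟨ cong₂ (λ x y → f 0 * derivative g (suc m) + (x + y))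
         (convolution-leibniz (f ∘ suc) g m) (convolution-suc (f ∘ suc) g m) ⟩
  f 0 * derivative g (suc m) + ((D + C′) + (f 1 * g (suc m) + D′))
    ≡⟨ solve 6 (λ a d c′ f₁ g₁ d′ → a :+ ((d :+ c′) :+ (f₁ :* g₁ :+ d′))
                                 := (con 1ℚ :* f₁ :* g₁ :+ (d :+ d′)) :+ (a :+ c′)) refl
         (f 0 * derivative g (suc m)) D C′ (f 1) (g (suc m)) D′ ⟩
  (derivative f 0 * g (suc m) + (D + D′)) + (f 0 * derivative g (suc m) + C′)
    ≡⟨ cong (λ x → (derivative f 0 * g (suc m) + x) + (f 0 * derivative g (suc m) + C′)) D+D′ ⟩
  (derivative f 0 * g (suc m) + convolution (derivative f ∘ suc) g m) + (f 0 * derivative g (suc m) + C′)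
    ≡⟨ cong₂ _+_ (convolution-suc (derivative f) g m) (convolution-suc f (derivative g) m) ⟨
  convolution (derivative f) g (suc m) + convolution f (derivative g) (suc m) ∎
  where
  C  = convolution (f ∘ suc) g (suc m)
  C′ = convolution (f ∘ suc) (derivative g) m
  D  = convolution (derivative (f ∘ suc)) g m
  D′ = convolution (λ a → f (2 ℕ.+ a)) g m

  D+D′ : D + D′ ≡ convolution (derivative f ∘ suc) g m
  D+D′ = trans (sym (∑-linear (upTo (suc m)) .+-homo (λ a → derivative (f ∘ suc) a * g (m ∸ a)) (λ a → f (2 ℕ.+ a) * g (m ∸ a))))
    (∑-linear (upTo (suc m)) .≗-cong (λ a → begin
    ι (suc a) * f (2 ℕ.+ a) * g (m ∸ a) + f (2 ℕ.+ a) * g (m ∸ a)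
      ≡⟨ solve 3 (λ i x y → i :* x :* y :+ x :* y := (i :+ con 1ℚ) :* x :* y) refl (ι (suc a)) (f (2 ℕ.+ a)) (g (m ∸ a)) ⟩
    (ι (suc a) + 1ℚ) * f (2 ℕ.+ a) * g (m ∸ a)
      ≡⟨ cong (λ i → i * f (2 ℕ.+ a) * g (m ∸ a)) (ι-suc (suc a)) ⟨
    ι (2 ℕ.+ a) * f (2 ℕ.+ a) * g (m ∸ a) ∎))

ι-suc-cancel : ∀ n {x y} → ι (suc n) * x ≡ ι (suc n) * y → x ≡ y
ι-suc-cancel n {x} {y} eq = begin
  x                                     ≡⟨ unit x ⟨
  (ℤ.+ 1 / suc n) * (ι (suc n) * x)     ≡⟨ cong ((ℤ.+ 1 / suc n) *_) eq ⟩
  (ℤ.+ 1 / suc n) * (ι (suc n) * y)     ≡⟨ unit y ⟩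
  y                                     ∎
  where
  unit : ∀ z → (ℤ.+ 1 / suc n) * (ι (suc n) * z) ≡ z
  unit z = begin
    (ℤ.+ 1 / suc n) * (ι (suc n) * z)   ≡⟨ solve 3 (λ q i z → q :* (i :* z) := i :* q :* z) refl (ℤ.+ 1 / suc n) (ι (suc n)) z ⟩
    ι (suc n) * (ℤ.+ 1 / suc n) * z     ≡⟨ cong (_* z) (ι-1/ (suc n)) ⟩
    1ℚ * z                              ≡⟨ *-identityˡ z ⟩
    z                                   ∎

-- Both sides solve F′ = (x + y)F with F(0) = 1, which determines the coefficients recursively.
expCoef-convolution : ∀ x y m → convolution (expCoef x) (expCoef y) m ≡ expCoef (x + y) m
expCoef-convolution x y zero    = refl
expCoef-convolution x y (suc m) = ι-suc-cancel m (begin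
  ι (suc m) * convolution (expCoef x) (expCoef y) (suc m)
    ≡⟨ convolution-leibniz (expCoef x) (expCoef y) m ⟩
  convolution (derivative (expCoef x)) (expCoef y) m + convolution (expCoef x) (derivative (expCoef y)) m
    ≡⟨ cong₂ _+_ (L .≗-cong left) (L .≗-cong right) ⟩
  ∑ (upTo (suc m)) (λ a → x * (expCoef x a * expCoef y (m ∸ a))) + ∑ (upTo (suc m)) (λ a → y * (expCoef x a * expCoef y (m ∸ a)))
    ≡⟨ cong₂ _+_ (L .*-homo x _) (L .*-homo y _) ⟩
  x * convolution (expCoef x) (expCoef y) m + y * convolution (expCoef x) (expCoef y) m
    ≡⟨ *-distribʳ-+ _ x y ⟨
  (x + y) * convolution (expCoef x) (expCoef y) m
    ≡⟨ cong ((x + y) *_) (expCoef-convolution x y m) ⟩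
  (x + y) * expCoef (x + y) m
    ≡⟨ expCoef-suc (x + y) m ⟨
  ι (suc m) * expCoef (x + y) (suc m) ∎)
  where
  L = ∑-linear (upTo (suc m))

  left : ∀ a → derivative (expCoef x) a * expCoef y (m ∸ a) ≡ x * (expCoef x a * expCoef y (m ∸ a))
  left a = trans (cong (_* expCoef y (m ∸ a)) (expCoef-suc x a)) (*-assoc x (expCoef x a) _)

  right : ∀ a → expCoef x a * derivative (expCoef y) (m ∸ a) ≡ y * (expCoef x a * expCoef y (m ∸ a))
  right a = trans (cong (expCoef x a *_) (expCoef-suc y (m ∸ a)))
    (solve 3 (λ p q r → p :* (q :* r) := q :* (p :* r)) refl (expCoef x a) y (expCoef y (m ∸ a)))

-- The coefficient of x^m in exp(Σ_ν (c + z₁ + ⋯ + z_ν) x_ν).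
prefixExp : ∀ {r} → ℚ → Vec ℚ r → FPS r
prefixExp c []       []       = 1ℚ
prefixExp c (z ∷ zs) (m ∷ ms) = expCoef (c + z) m * prefixExp (c + z) zs ms

factVec-prefixExp : ∀ {r} c (z : Vec ℚ r) m → ι (factVec m) * prefixExp c z m ≡ prefixMonomial c m z
factVec-prefixExp c []       []       = refl
factVec-prefixExp c (z ∷ zs) (m ∷ ms) = begin
  ι (m ! ℕ.* factVec ms) * (y ^ℚ m * (ℤ.+ 1 / (m !)) * prefixExp y zs ms)
    ≡⟨ cong (_* (y ^ℚ m * (ℤ.+ 1 / (m !)) * prefixExp y zs ms)) (ι-* (m !) (factVec ms)) ⟩
  ι (m !) * ι (factVec ms) * (y ^ℚ m * (ℤ.+ 1 / (m !)) * prefixExp y zs ms)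
    ≡⟨ solve 5 (λ i j p q e → i :* j :* (p :* q :* e) := (i :* q) :* (p :* (j :* e))) refl
         (ι (m !)) (ι (factVec ms)) (y ^ℚ m) (ℤ.+ 1 / (m !)) (prefixExp y zs ms) ⟩
  (ι (m !) * (ℤ.+ 1 / (m !))) * (y ^ℚ m * (ι (factVec ms) * prefixExp y zs ms))
    ≡⟨ cong₂ (λ a b → a * (y ^ℚ m * b)) (ι-1/ (m !)) (factVec-prefixExp y zs ms) ⟩
  1ℚ * (y ^ℚ m * prefixMonomial y ms zs)
    ≡⟨ *-identityˡ _ ⟩
  y ^ℚ m * prefixMonomial y ms zs ∎
  where
  instance _ = m !≢0
  y = c + z

prefixExp-⊛ : ∀ {r} c d (z w : Vec ℚ r) m →
              (prefixExp c z ⊛ prefixExp d w) m ≡ prefixExp (c + d) (zipWith _+_ z w) m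
prefixExp-⊛ c d []       []       []       = refl
prefixExp-⊛ c d (z ∷ zs) (w ∷ ws) (m ∷ ms) = begin
  ∑ (below (m ∷ ms)) (λ a → prefixExp c (z ∷ zs) a * prefixExp d (w ∷ ws) ((m ∷ ms) ∸v a))
    ≡⟨ ∑-below m ms (λ a → prefixExp c (z ∷ zs) a * prefixExp d (w ∷ ws) ((m ∷ ms) ∸v a)) ⟩
  ∑ (upTo (suc m)) (λ a → ∑ (below ms) (λ as → (ex a * P as) * (ey (m ∸ a) * Q (ms ∸v as))))
    ≡⟨ ∑-linear (upTo (suc m)) .≗-cong factor ⟩
  ∑ (upTo (suc m)) (λ a → (ex a * ey (m ∸ a)) * (P ⊛ Q) ms)
    ≡⟨ *-homoʳ (∑-linear (upTo (suc m))) ((P ⊛ Q) ms) (λ a → ex a * ey (m ∸ a)) ⟩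
  convolution ex ey m * (P ⊛ Q) ms
    ≡⟨ cong₂ _*_ (expCoef-convolution (c + z) (d + w) m) (prefixExp-⊛ (c + z) (d + w) zs ws ms) ⟩
  expCoef (c + z + (d + w)) m * prefixExp (c + z + (d + w)) (zipWith _+_ zs ws) ms
    ≡⟨ cong (λ y → expCoef y m * prefixExp y (zipWith _+_ zs ws) ms)
         (solve 4 (λ c d z w → c :+ z :+ (d :+ w) := c :+ d :+ (z :+ w)) refl c d z w) ⟩
  expCoef (c + d + (z + w)) m * prefixExp (c + d + (z + w)) (zipWith _+_ zs ws) ms ∎
  where
  ex = expCoef (c + z)
  ey = expCoef (d + w)
  P  = prefixExp (c + z) zs
  Q  = prefixExp (d + w) ws

  factor : ∀ a → ∑ (below ms) (λ as → (ex a * P as) * (ey (m ∸ a) * Q (ms ∸v as)))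
               ≡ (ex a * ey (m ∸ a)) * (P ⊛ Q) ms
  factor a = trans
    (∑-linear (below ms) .≗-cong (λ as →
      solve 4 (λ p q r s → (p :* q) :* (r :* s) := (p :* r) :* (q :* s)) refl
        (ex a) (P as) (ey (m ∸ a)) (Q (ms ∸v as))))
    (∑-linear (below ms) .*-homo (ex a * ey (m ∸ a)) (λ as → P as * Q (ms ∸v as)))

-- F is the combination of exponential series prescribed by the functional φ.
Represents : ∀ {r} → FPS r → ((Vec ℚ r → ℚ) → ℚ) → Set
Represents F φ = ∀ m → F m ≡ φ (λ z → prefixExp 0ℚ z m)

-- Convolution of functionals along vector addition: a product of exponential series adds their
-- exponents.
_✶_ : ∀ {r} → ((Vec ℚ r → ℚ) → ℚ) → ((Vec ℚ r → ℚ) → ℚ) → (Vec ℚ r → ℚ) → ℚ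
(φ ✶ ψ) g = φ (λ z → ψ (λ w → g (zipWith _+_ z w)))

✶-linear : ∀ {r} {φ ψ : (Vec ℚ r → ℚ) → ℚ} → IsLinear φ → IsLinear ψ → IsLinear (φ ✶ ψ)
✶-linear p q = ∘-linear p (λ z → reindex-linear q (zipWith _+_ z))

⊛-represents : ∀ {r} {F G : FPS r} {φ ψ} → IsLinear φ → IsLinear ψ →
               Represents F φ → Represents G ψ → Represents (F ⊛ G) (φ ✶ ψ)
⊛-represents {F = F} {G} {φ} {ψ} p q F~φ G~ψ m = begin
  ∑ (below m) (λ a → F a * G (m ∸v a))
    ≡⟨ ∑-linear (below m) .≗-cong (λ a → begin
         F a * G (m ∸v a)
           ≡⟨ cong₂ _*_ (F~φ a) (G~ψ (m ∸v a)) ⟩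
         φ (λ z → prefixExp 0ℚ z a) * ψ (λ w → prefixExp 0ℚ w (m ∸v a))
           ≡⟨ *-homoʳ p _ _ ⟨
         φ (λ z → prefixExp 0ℚ z a * ψ (λ w → prefixExp 0ℚ w (m ∸v a)))
           ≡⟨ p .≗-cong (λ z → sym (q .*-homo (prefixExp 0ℚ z a) (λ w → prefixExp 0ℚ w (m ∸v a)))) ⟩
         φ (λ z → ψ (λ w → prefixExp 0ℚ z a * prefixExp 0ℚ w (m ∸v a))) ∎) ⟩
  ∑ (below m) (λ a → φ (λ z → ψ (λ w → prefixExp 0ℚ z a * prefixExp 0ℚ w (m ∸v a))))
    ≡⟨ linear-∑ p (below m) _ ⟨
  φ (λ z → ∑ (below m) (λ a → ψ (λ w → prefixExp 0ℚ z a * prefixExp 0ℚ w (m ∸v a))))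
    ≡⟨ p .≗-cong (λ z → linear-∑ q (below m) (λ a w → prefixExp 0ℚ z a * prefixExp 0ℚ w (m ∸v a))) ⟨
  φ (λ z → ψ (λ w → (prefixExp 0ℚ z ⊛ prefixExp 0ℚ w) m))
    ≡⟨ p .≗-cong (λ z → q .≗-cong (λ w → prefixExp-⊛ 0ℚ 0ℚ z w m)) ⟩
  (φ ✶ ψ) (λ z → prefixExp 0ℚ z m) ∎

-- The series 1 - e^{-X_j}

0ᵛ : ∀ {r} → Vec ℚ r
0ᵛ = replicate _ 0ℚ

-unit : ∀ {r} → Fin r → Vec ℚ r
-unit zero    = - 1ℚ ∷ 0ᵛ
-unit (suc j) = 0ℚ ∷ -unit j

expCoef-0 : ∀ a → expCoef 0ℚ a ≡ oneCoef a
expCoef-0 zero    = refl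
expCoef-0 (suc a) = trans (cong (_* (ℤ.+ 1 / (suc a !))) (*-zeroˡ (0ℚ ^ℚ a))) (*-zeroˡ (ℤ.+ 1 / (suc a !)))
  where instance _ = suc a !≢0

oneS-represents : ∀ {r} → Represents {r} oneS (λ g → g 0ᵛ)
oneS-represents []           = refl
oneS-represents (zero ∷ ms)  = trans (oneS-represents ms) (sym (*-identityˡ _))
oneS-represents (suc m ∷ ms) = sym (trans (cong (_* prefixExp 0ℚ 0ᵛ ms) (expCoef-0 (suc m))) (*-zeroˡ (prefixExp 0ℚ 0ᵛ ms)))

-- `expNegCoef` is by definition `expCoef (- 1ℚ)`, and the closed sum `- 1ℚ + 0ℚ` computes, so the
-- offset stays constant.
expNegXAux-zero : ∀ {r} ν (m : Vec ℕ r) → expNegXAux 0 ν m ≡ prefixExp (- 1ℚ) 0ᵛ m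
expNegXAux-zero ν []       = refl
expNegXAux-zero ν (m ∷ ms) = cong (expNegCoef m *_) (expNegXAux-zero (suc ν) ms)

-- The case split on `j` lets `≤ᵇ` compute.
expNegXAux-suc : ∀ {r} j ν (m : Vec ℕ r) → expNegXAux (suc j) (suc ν) m ≡ expNegXAux j ν m
expNegXAux-suc j       ν []       = refl
expNegXAux-suc zero    ν (m ∷ ms) = cong (expNegCoef m *_) (expNegXAux-suc zero (suc ν) ms)
expNegXAux-suc (suc j) ν (m ∷ ms) = 
  cong ((if suc j ℕ.≤ᵇ ν then expNegCoef m else oneCoef m) *_) (expNegXAux-suc (suc j) (suc ν) ms)

-- Lowering z_j by one lowers exactly the prefix sums with ν ≥ j, each by one.
expNegX-prefixExp : ∀ {r} (j : Fin r) m → expNegX j m ≡ prefixExp 0ℚ (-unit j) m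
expNegX-prefixExp zero    (m ∷ ms) = cong (expNegCoef m *_) (expNegXAux-zero 1 ms)
expNegX-prefixExp (suc j) (m ∷ ms) = cong₂ _*_ (sym (expCoef-0 m))
  (trans (expNegXAux-suc (toℕ j) 0 ms) (expNegX-prefixExp j ms))

functionalT : ∀ {r} → Fin r → (Vec ℚ r → ℚ) → ℚ
functionalT j g = g 0ᵛ - g (-unit j)

functionalT-linear : ∀ {r} (j : Fin r) → IsLinear (functionalT j)
functionalT-linear j = difference-linear (eval-linear 0ᵛ) (eval-linear (-unit j))

T-represents : ∀ {r} (j : Fin r) → Represents (T j) (functionalT j)
T-represents j m = cong₂ _-_ (oneS-represents m) (expNegX-prefixExp j m)

functionalT^ : ∀ {r} → Fin r → ℕ → (Vec ℚ r → ℚ) → ℚ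
functionalT^ j zero    = λ g → g 0ᵛ
functionalT^ j (suc n) = functionalT j ✶ functionalT^ j n

functionalT^-linear : ∀ {r} (j : Fin r) n → IsLinear (functionalT^ j n)
functionalT^-linear j zero    = eval-linear 0ᵛ
functionalT^-linear j (suc n) = ✶-linear (functionalT-linear j) (functionalT^-linear j n)

powS-represents : ∀ {r} (j : Fin r) n → Represents (powS (T j) n) (functionalT^ j n)
powS-represents j zero    = oneS-represents
powS-represents j (suc n) = ⊛-represents (functionalT-linear j) (functionalT^-linear j n)
  (T-represents j) (powS-represents j n)

functionalΠT : ∀ {r q} → Vec (Fin r) q → Vec ℕ q → (Vec ℚ r → ℚ) → ℚ
functionalΠT []       []       = λ g → g 0ᵛ
functionalΠT (j ∷ js) (n ∷ ns) = functionalT^ j n ✶ functionalΠT js ns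

functionalΠT-linear : ∀ {r q} (js : Vec (Fin r) q) ns → IsLinear (functionalΠT js ns)
functionalΠT-linear []       []       = eval-linear 0ᵛ
functionalΠT-linear (j ∷ js) (n ∷ ns) = ✶-linear (functionalT^-linear j n) (functionalΠT-linear js ns)

-- The step of `prodT` is a pattern-matching lambda, which cannot be written again as an equal term;
-- it is abstracted to `step` with its defining equation, and unification supplies it.
foldr-represents : ∀ {r q} (step : ∀ {n : ℕ} → Fin r × ℕ → FPS r → FPS r) →
                   (∀ {i} j n F → step {i} (j , n) F ≡ powS (T j) n ⊛ F) →
                   (js : Vec (Fin r) q) (ns : Vec ℕ q) →
                   Represents (Vec.foldr (λ _ → FPS r) (λ {i} → step {i}) oneS (Vec.zip js ns)) (functionalΠT js ns)
foldr-represents step eq []       []       = oneS-represents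
foldr-represents {r} step eq (j ∷ js) (n ∷ ns) m = trans
  (cong (λ F → F m) (eq j n _))
  (⊛-represents (functionalT^-linear j n) (functionalΠT-linear js ns)
    (powS-represents j n) (foldr-represents step eq js ns) m)

prodT-represents : ∀ {r} (n : Vec ℕ r) → Represents (prodT n) (functionalΠT (allFin r) n)
prodT-represents {r} n = foldr-represents _ (λ j n F → refl) (allFin r) n

-- From functionals on vectors to mixed differences

+ᵛ-identityˡ : ∀ {r} (v : Vec ℚ r) → zipWith _+_ 0ᵛ v ≡ v
+ᵛ-identityˡ = zipWith-identityˡ +-identityˡ

functionalT^-zero : ∀ {r} n (g : Vec ℚ (suc r) → ℚ) →
                    functionalT^ zero n g ≡ ∇^ n (λ z → g (z ∷ 0ᵛ)) 0ℚ
functionalT^-zero zero    g = refl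
functionalT^-zero (suc n) g = begin
  functionalT^ zero n (λ w → g (zipWith _+_ 0ᵛ w)) - functionalT^ zero n (λ w → g (zipWith _+_ (-unit zero) w))
    ≡⟨ cong₂ _-_ (functionalT^-zero n _) (functionalT^-zero n _) ⟩
  ∇^ n (λ z → g (0ℚ + z ∷ zipWith _+_ 0ᵛ 0ᵛ)) 0ℚ - ∇^ n (λ z → g (- 1ℚ + z ∷ zipWith _+_ 0ᵛ 0ᵛ)) 0ℚ
    ≡⟨ sub-homo (∇^-linear n 0ℚ) _ _ ⟨
  ∇^ n (λ z → g (0ℚ + z ∷ zipWith _+_ 0ᵛ 0ᵛ) - g (- 1ℚ + z ∷ zipWith _+_ 0ᵛ 0ᵛ)) 0ℚ
    ≡⟨ ∇^-cong n (λ z → cong₂ _-_ (cong g (cong₂ _∷_ (+-identityˡ z) (+ᵛ-identityˡ 0ᵛ)))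
                                  (cong g (cong₂ _∷_ (+-comm (- 1ℚ) z) (+ᵛ-identityˡ 0ᵛ)))) 0ℚ ⟩
  ∇^ (suc n) (λ z → g (z ∷ 0ᵛ)) 0ℚ ∎

functionalT^-suc : ∀ {r} (j : Fin r) n g → functionalT^ (suc j) n g ≡ functionalT^ j n (λ v → g (0ℚ ∷ v))
functionalT^-suc j zero    g = refl
functionalT^-suc j (suc n) g = cong₂ _-_ (functionalT^-suc j n _) (functionalT^-suc j n _)

functionalΠT-suc : ∀ {r q} (js : Vec (Fin r) q) ns g →
                   functionalΠT (Vec.map suc js) ns g ≡ functionalΠT js ns (λ v → g (0ℚ ∷ v))
functionalΠT-suc []       []       g = refl
functionalΠT-suc (j ∷ js) (n ∷ ns) g = trans
  (functionalT^-suc j n _)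
  (functionalT^-linear j n .≗-cong (λ z → functionalΠT-suc js ns (λ w → g (zipWith _+_ (0ℚ ∷ z) w))))

-- Only the factor for index `zero` moves the first coordinate; the others see it as a constant,
-- which leaves the same statement in one dimension less.
functionalΠT-mixed∇ : ∀ {r} (ns : Vec ℕ r) g → functionalΠT (allFin r) ns g ≡ mixed∇ ns g
functionalΠT-mixed∇         []       g = refl
functionalΠT-mixed∇ {suc r} (n ∷ ns) g = begin
  functionalT^ zero n (λ z → functionalΠT (Vec.tabulate suc) ns (λ w → g (zipWith _+_ z w)))
    ≡⟨ functionalT^-zero n _ ⟩
  ∇^ n (λ z → functionalΠT (Vec.tabulate suc) ns (λ w → g (zipWith _+_ (z ∷ 0ᵛ) w))) 0ℚ
    ≡⟨ ∇^-cong n (λ z → begin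
         functionalΠT (Vec.tabulate suc) ns (λ w → g (zipWith _+_ (z ∷ 0ᵛ) w))
           ≡⟨ cong (λ js → functionalΠT js ns (λ w → g (zipWith _+_ (z ∷ 0ᵛ) w))) (tabulate-allFin suc) ⟩
         functionalΠT (Vec.map suc (allFin r)) ns (λ w → g (zipWith _+_ (z ∷ 0ᵛ) w))
           ≡⟨ functionalΠT-suc (allFin r) ns _ ⟩
         functionalΠT (allFin r) ns (λ v → g (z + 0ℚ ∷ zipWith _+_ 0ᵛ v))
           ≡⟨ functionalΠT-linear (allFin r) ns .≗-cong (λ v → cong g (cong₂ _∷_ (+-identityʳ z) (+ᵛ-identityˡ v))) ⟩
         functionalΠT (allFin r) ns (λ v → g (z ∷ v))
           ≡⟨ functionalΠT-mixed∇ ns _ ⟩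
         mixed∇ ns (λ v → g (z ∷ v)) ∎) 0ℚ ⟩
  mixed∇ (n ∷ ns) g ∎

factVec-prodT : ∀ {r} (n m : Vec ℕ r) → ι (factVec m) * prodT n m ≡ mixed∇ n (prefixMonomial 0ℚ m)
factVec-prodT n m = begin
  ι (factVec m) * prodT n m
    ≡⟨ cong (ι (factVec m) *_) (trans (prodT-represents n m) (functionalΠT-mixed∇ n _)) ⟩
  ι (factVec m) * mixed∇ n (λ z → prefixExp 0ℚ z m)
    ≡⟨ mixed∇-linear n .*-homo (ι (factVec m)) _ ⟨
  mixed∇ n (λ z → ι (factVec m) * prefixExp 0ℚ z m)
    ≡⟨ mixed∇-linear n .≗-cong (λ z → factVec-prefixExp 0ℚ z m) ⟩
  mixed∇ n (prefixMonomial 0ℚ m) ∎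

-- Duality of the numbers 𝔹

kernel : ∀ {r} → Vec ℕ r → Vec ℕ r → Vec ℚ r × Vec ℚ r → ℚ
kernel k m (u , v) = prefixMonomial 0ℚ k u * prefixMonomial 0ℚ m v

-- The cutoff |m| of `Gcoef` is inclusive, hence `suc`; the shift l_j = n_j + 1 is the one in `ι⁺`.
𝔹-form : ∀ {r} (k m : Vec ℕ r) → 𝔹 k m ≡ form (suc (totalDeg m)) (kernel k m)
𝔹-form {r} k m = begin
  ι (factVec m) * ∑ ns (λ n → ι (weight k n) * prodT n m)
    ≡⟨ ∑-linear ns .*-homo (ι (factVec m)) _ ⟨
  ∑ ns (λ n → ι (factVec m) * (ι (weight k n) * prodT n m))
    ≡⟨ ∑-linear ns .≗-cong term ⟩
  ∑ ns (λ n → mixed∇ n (λ v → kernel k m (ι⁺ n , v)))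
    ≡⟨ form-∑ r (totalDeg m) (kernel k m) ⟨
  form (suc (totalDeg m)) (kernel k m) ∎
  where
  ns = below (replicate r (totalDeg m))

  term : ∀ n → ι (factVec m) * (ι (weight k n) * prodT n m) ≡ mixed∇ n (λ v → kernel k m (ι⁺ n , v))
  term n = begin
    ι (factVec m) * (ι (weight k n) * prodT n m)
      ≡⟨ solve 3 (λ a b c → a :* (b :* c) := b :* (a :* c)) refl (ι (factVec m)) (ι (weight k n)) (prodT n m) ⟩
    ι (weight k n) * (ι (factVec m) * prodT n m)
      ≡⟨ cong₂ _*_ (prefixMonomial-weight 0 k n) (factVec-prodT n m) ⟩
    prefixMonomial 0ℚ k (ι⁺ n) * mixed∇ n (prefixMonomial 0ℚ m)
      ≡⟨ mixed∇-linear n .*-homo (prefixMonomial 0ℚ k (ι⁺ n)) (prefixMonomial 0ℚ m) ⟨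
    mixed∇ n (λ v → kernel k m (ι⁺ n , v)) ∎

kernel-RightDeg< : ∀ {r} N (k m : Vec ℕ r) → totalDeg m ℕ.< N → RightDeg< N (kernel k m)
kernel-RightDeg< N k m lt = RightDeg<-prefixMonomial N 0ℚ m lt (prefixMonomial 0ℚ k) (λ u v → refl)

form-kernel-comm : ∀ {r} N (k m : Vec ℕ r) → totalDeg k ℕ.< N → totalDeg m ℕ.< N →
                   form N (kernel k m) ≡ form N (kernel m k)
form-kernel-comm {r} N k m k<N m<N = trans
  (form-swap r N (kernel k m) (kernel-RightDeg< N k m m<N)
    (RightDeg<-prefixMonomial N 0ℚ k k<N (prefixMonomial 0ℚ m) (λ u v → *-comm (prefixMonomial 0ℚ k v) _)))
  (form-linear r N .≗-cong (λ (u , v) → *-comm (prefixMonomial 0ℚ k v) _))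

theorem5p4 : (r : ℕ) (k m : Vec ℕ r) → 𝔹 k m ≡ 𝔹 m k
theorem5p4 r k m = begin
  𝔹 k m
    ≡⟨ 𝔹-form k m ⟩
  form (suc M) (kernel k m)
    -- The two sides have cutoffs |m| + 1 and |k| + 1; the common value |k| + |m| + 1 exceeds both
    -- degrees, as the swap requires.
    ≡⟨ form-extend r K (suc M) _ (kernel-RightDeg< (suc M) k m ℕₚ.≤-refl) ⟨
  form (K ℕ.+ suc M) (kernel k m)
    ≡⟨ form-kernel-comm (K ℕ.+ suc M) k m (subst (K ℕ.<_) (sym K+1+M) (ℕₚ.m≤n+m (suc K) M)) (ℕₚ.m≤n+m (suc M) K) ⟩
  form (K ℕ.+ suc M) (kernel m k)
    ≡⟨ cong (λ N → form N (kernel m k)) K+1+M ⟩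
  form (M ℕ.+ suc K) (kernel m k)
    ≡⟨ form-extend r M (suc K) _ (kernel-RightDeg< (suc K) m k ℕₚ.≤-refl) ⟩
  form (suc K) (kernel m k)
    ≡⟨ 𝔹-form m k ⟨
  𝔹 m k ∎
  where
  K = totalDeg k
  M = totalDeg m

  K+1+M : K ℕ.+ suc M ≡ M ℕ.+ suc K
  K+1+M = trans (ℕₚ.+-suc K M) (trans (cong suc (ℕₚ.+-comm K M)) (sym (ℕₚ.+-suc M K)))
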